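{- Let $G$ be a connected graph with vertex set $\{u_1,\dots,u_n\}$, $n\ge2$, having no pair of distinct true twins, and let $\mathcal{H}=\{H_1,\dots,H_n\}$ be a family of non-empty graphs, $H_i$ of order $n_i$. Then $\dim_l(G\circ\mathcal{H})=\sum_{i=1}^n n_i-n$ if and only if $H_i\cong K_{n_i}$ for all $i$.
   Context: All graphs are finite and simple; non-empty means having at least one edge. True twins: distinct vertices $x,y$ with $N[x]=N[y]$. For a connected graph $G$, $\dim_l(G)$ is the minimum size of $S\subseteq V(G)$ such that for every two adjacent vertices $x,y$ there is $s\in S$ with $d_G(s,x)\ne d_G(s,y)$ ($d_G$ the shortest-path distance). Lexicographic product $G\circ\mathcal{H}$: vertex set $\bigcup_i\{u_i\}\times V(H_i)$, $(u_i,v)\sim(u_j,w)$ iff $u_iu_j\in E(G)$, or $i=j$ and $vw\in E(H_i)$. -}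

module Defs where

open import Data.Fin.Base using (Fin)
open import Data.Fin.Properties using (_≟_)
open import Data.List.Base using (List; length)
open import Data.List.Membership.Propositional using (_∈_)
open import Data.List.Relation.Unary.Unique.Propositional using (Unique)
open import Data.Nat.Base using (ℕ; zero; suc; _≤_)
open import Data.Nat.Properties using (≤-antisym; +-0-commutativeMonoid)
open import Data.Product.Base using (Σ; ∃; ∃₂; _×_; _,_)
open import Data.Sum.Base using (_⊎_)
open import Function.Bundles using (_↔_; _⇔_; Inverse)
open import Relation.Binary.Core using (Rel)
open import Relation.Binary.Definitions using (Symmetric; Irreflexive; Decidable)
open import Relation.Binary.PropositionalEquality using (_≡_; _≢_; refl; sym)
open import Relation.Nullary using (yes; no; ¬?)
open import Level using (0ℓ)

open import Algebra.Properties.CommutativeMonoid.Sum +-0-commutativeMonoid public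
  using (sum)

-- A simple graph on the vertex type V.  A finite graph of order n is an
-- element of Graph (Fin n).
record Graph (V : Set) : Set₁ where
  field
    Adj        : Rel V 0ℓ
    adj-sym    : Symmetric Adj
    adj-irrefl : Irreflexive _≡_ Adj
    adj?       : Decidable Adj

open Graph public

NonEmpty : {V : Set} → Graph V → Set
NonEmpty G = ∃₂ λ x y → Adj G x y

InClosedNbhd : {V : Set} → Graph V → V → V → Set
InClosedNbhd G x z = z ≡ x ⊎ Adj G x z

TrueTwins : {V : Set} → Graph V → V → V → Set
TrueTwins G x y = x ≢ y × (∀ z → InClosedNbhd G x z ⇔ InClosedNbhd G y z)

data Walk {V : Set} (G : Graph V) : V → V → ℕ → Set where
  []  : ∀ {x} → Walk G x x zero
  _∷_ : ∀ {x y z k} → Adj G x y → Walk G y z k → Walk G x z (suc k)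

Connected : {V : Set} → Graph V → Set
Connected G = ∀ x y → ∃ λ k → Walk G x y k

-- Distance as a functional relation: IsDist G x y k says d_G(x,y) = k.
-- A walk of minimum length is automatically a path.
IsDist : {V : Set} → Graph V → V → V → ℕ → Set
IsDist G x y k = Walk G x y k × (∀ {l} → Walk G x y l → k ≤ l)

-- d_G(s,x) ≠ d_G(s,y).
Distinguishes : {V : Set} → Graph V → V → V → V → Set
Distinguishes G s x y = ∃₂ λ k l → IsDist G s x k × IsDist G s y l × k ≢ l

LocallyResolving : {V : Set} → Graph V → List V → Set
LocallyResolving G S =
  ∀ {x y} → Adj G x y → ∃ λ s → s ∈ S × Distinguishes G s x y

-- IsLocalDim G k says dim_l(G) = k, for connected G.  Finite vertex sets are
-- duplicate-free lists, their size being the length.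
IsLocalDim : {V : Set} → Graph V → ℕ → Set
IsLocalDim {V} G k =
  (Σ (List V) λ S → Unique S × LocallyResolving G S × length S ≡ k) ×
  (∀ (S : List V) → Unique S → LocallyResolving G S → k ≤ length S)

isLocalDim-unique : {V : Set} (G : Graph V) {k l : ℕ} →
                    IsLocalDim G k → IsLocalDim G l → k ≡ l
isLocalDim-unique G ((S , uS , rS , refl) , minS) ((T , uT , rT , refl) , minT) =
  ≤-antisym (minS T uT rT) (minT S uS rS)

infix 4 _≅_

record _≅_ {V W : Set} (G : Graph V) (H : Graph W) : Set where
  field
    bijection : V ↔ W
    adj-⇔     : ∀ x y → Adj G x y ⇔
                  Adj H (Inverse.to bijection x) (Inverse.to bijection y)

K : (n : ℕ) → Graph (Fin n)
K n = record
  { Adj        = _≢_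
  ; adj-sym    = λ x≢y y≡x → x≢y (sym y≡x)
  ; adj-irrefl = λ x≡y x≢y → x≢y x≡y
  ; adj?       = λ x y → ¬? (x ≟ y)
  }

module _ {n : ℕ} {m : Fin n → ℕ}
         (G : Graph (Fin n)) (H : (i : Fin n) → Graph (Fin (m i))) where

  data LexAdj : Rel (Σ (Fin n) λ i → Fin (m i)) 0ℓ where
    outer : ∀ {i j v w} → Adj G i j → LexAdj (i , v) (j , w)
    inner : ∀ {i v w} → Adj (H i) v w → LexAdj (i , v) (i , w)

  private
    lex-sym : Symmetric LexAdj
    lex-sym (outer e) = outer (adj-sym G e)
    lex-sym (inner e) = inner (adj-sym (H _) e)

    lex-irrefl : Irreflexive _≡_ LexAdj
    lex-irrefl refl (outer e) = adj-irrefl G refl e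
    lex-irrefl refl (inner e) = adj-irrefl (H _) refl e

    lex? : Decidable LexAdj
    lex? (i , v) (j , w) with adj? G i j
    ... | yes e = yes (outer e)
    ... | no ¬e with i ≟ j
    ...   | no i≢j = no λ { (outer e) → ¬e e ; (inner _) → i≢j refl }
    ...   | yes refl with adj? (H i) v w
    ...     | yes f = yes (inner f)
    ...     | no ¬f = no λ { (outer e) → ¬e e ; (inner f) → ¬f f }

  infix 8 _⊚_

  _⊚_ : Graph (Σ (Fin n) λ i → Fin (m i))
  _⊚_ = record
    { Adj        = LexAdj
    ; adj-sym    = lex-sym
    ; adj-irrefl = lex-irrefl
    ; adj?       = lex?
    }

{-# OPTIONS --safe #-}
-- A union of vertex covers of the layers is locally resolving: adjacent vertices
-- of one layer are separated by whichever of them lies in the cover, and vertices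
-- in adjacent layers i, j are separated by any chosen vertex of a layer witnessing
-- that i and j are not true twins.  Dropping one vertex per layer, or two
-- non-adjacent vertices from one layer, leaves such a union.  Conversely, two
-- vertices of a complete layer are true twins of the product, so a locally
-- resolving set misses at most one vertex of each complete layer.
module Submission where

open import Defs
open import Data.Nat.Base using (ℕ; zero; suc; _+_; _≤_; _<_; _∸_; z≤n; s≤s)
open import Data.Fin.Base using (Fin; zero; suc)
open import Function.Bundles using (_⇔_)
open import Relation.Nullary using (¬_)

open import Data.Nat.Properties
  using (≤-trans; ≤-antisym; <-irrefl; <⇒≤; +-suc; +-assoc; +-comm; +-mono-≤; +-mono-<-≤; +-mono-≤-<;
         m≤n+o⇒m∸n≤o; m+n≤o⇒m≤o∸n; +-0-commutativeMonoid; module ≤-Reasoning)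
open import Algebra.Properties.CommutativeMonoid.Sum +-0-commutativeMonoid using (sum-cong-≗)
open import Data.Empty using (⊥-elim)
open import Data.Fin.Properties using (_≟_; any?)
open import Data.List.Base using (List; []; _∷_; _++_; length; map; filter; concat; tabulate; allFin)
open import Data.List.Membership.DecPropositional using () renaming (_∈?_ to mem?)
open import Data.List.Membership.Propositional using (_∈_; lose)
open import Data.List.Membership.Propositional.Properties
  using (∈-filter⁺; ∈-map⁺; ∈-map⁻; ∈-++⁺ˡ; ∈-++⁺ʳ; ∈-concat⁺′; ∈-tabulate⁺; ∈-allFin)
open import Data.List.Properties using (filter-notAll; length-++; length-map; length-tabulate)
open import Data.List.Relation.Binary.Subset.Propositional using (_⊆_)
import Data.List.Relation.Unary.All as All
import Data.List.Relation.Unary.All.Properties as All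
import Data.List.Relation.Unary.AllPairs.Properties as AllPairs
open import Data.List.Relation.Unary.AllPairs using ([]; _∷_)
open import Data.List.Relation.Unary.Any using (here; there)
open import Data.List.Relation.Unary.Unique.Propositional using (Unique)
open import Data.List.Relation.Unary.Unique.Propositional.Properties
  using (filter⁺; map⁺; concat⁺; allFin⁺)
open import Data.Product.Base using (Σ; ∃; _×_; _,_; proj₁; proj₂)
open import Data.Product.Properties using (≡-dec)
open import Data.Sum.Base using (_⊎_; inj₁; inj₂)
open import Function.Base using (id; _∘_)
open import Function.Bundles using (mk⇔; Equivalence; Injection)
open import Function.Construct.Identity using (↔-id)
open import Function.Properties.Inverse using (↔⇒↣)
open import Relation.Binary.Definitions using (DecidableEquality)
open import Relation.Binary.PropositionalEquality
  using (_≡_; _≢_; refl; sym; trans; cong; subst; ≢-sym)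
open import Relation.Nullary using (Dec; yes; no; ¬?; _×-dec_; _⊎-dec_; decidable-stable)

-- Sums over `Fin n`.

sum-suc : ∀ {n} (f : Fin n → ℕ) → sum (suc ∘ f) ≡ sum f + n
sum-suc {zero}  f = refl
sum-suc {suc n} f = trans (cong (λ k → suc (f zero + k)) (sum-suc (f ∘ suc)))
  (trans (cong suc (sym (+-assoc (f zero) _ n))) (sym (+-suc _ n)))

sum-mono-≤ : ∀ {n} {f g : Fin n → ℕ} → (∀ i → f i ≤ g i) → sum f ≤ sum g
sum-mono-≤ {zero}  f≤g = z≤n
sum-mono-≤ {suc n} f≤g = +-mono-≤ (f≤g zero) (sum-mono-≤ (f≤g ∘ suc))

sum-mono-< : ∀ {n} {f g : Fin n → ℕ} → (∀ i → f i ≤ g i) →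
             ∀ i → f i < g i → sum f < sum g
sum-mono-< f≤g zero    lt = +-mono-<-≤ lt (sum-mono-≤ (f≤g ∘ suc))
sum-mono-< f≤g (suc i) lt = +-mono-≤-< (f≤g zero) (sum-mono-< (f≤g ∘ suc) i lt)

-- Counting with duplicate-free lists.

module _ {A : Set} (_≟ᴬ_ : DecidableEquality A) where

  without : A → List A → List A
  without a = filter (λ x → ¬? (x ≟ᴬ a))

  length-without : ∀ {a xs} → a ∈ xs → length (without a xs) < length xs
  length-without a∈xs = filter-notAll _ _ (lose a∈xs λ a≢a → a≢a refl)

  ∈-without : ∀ {a x xs} → x ∈ xs → x ≢ a → x ∈ without a xs
  ∈-without = ∈-filter⁺ _

  -- Induction on `xs`: delete its head from `ys`. The head does not recur in the tail, so the tail
  -- still lies in what is left, and `ys` has become strictly shorter.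
  unique-⊆⇒length-≤ : ∀ {xs ys} → Unique xs → xs ⊆ ys → length xs ≤ length ys
  unique-⊆⇒length-≤ []         sub = z≤n
  unique-⊆⇒length-≤ (x∉ ∷ xs!) sub = ≤-trans
    (s≤s (unique-⊆⇒length-≤ xs! λ y∈xs →
      ∈-without (sub (there y∈xs)) (≢-sym (All.lookup x∉ y∈xs))))
    (length-without (sub (here refl)))

-- Vertex sets assembled layer by layer.

module _ {n : ℕ} {m : Fin n → ℕ} where

  layered : (∀ i → List (Fin (m i))) → List (Σ (Fin n) λ i → Fin (m i))
  layered C = concat (tabulate λ i → map (i ,_) (C i))

  layered-unique : ∀ {C} → (∀ i → Unique (C i)) → Unique (layered C)
  layered-unique C! = concat⁺
    (All.tabulate⁺ λ i → map⁺ (λ { refl → refl }) (C! i))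
    -- A common element of two layers would have both indices as its first coordinate.
    (AllPairs.tabulate⁺ λ i≢j (p , q) → i≢j
      (trans (sym (cong proj₁ (proj₂ (proj₂ (∈-map⁻ _ p)))))
             (cong proj₁ (proj₂ (proj₂ (∈-map⁻ _ q))))))

  ∈-layered : ∀ {C i v} → v ∈ C i → (i , v) ∈ layered C
  ∈-layered {i = i} v∈ = ∈-concat⁺′ (∈-map⁺ (i ,_) v∈) (∈-tabulate⁺ i)

length-concat-tabulate : ∀ {A : Set} {n} (f : Fin n → List A) →
                         length (concat (tabulate f)) ≡ sum (length ∘ f)
length-concat-tabulate {n = zero}  f = refl
length-concat-tabulate {n = suc n} f =
  trans (length-++ (f zero)) (cong (length (f zero) +_) (length-concat-tabulate (f ∘ suc)))

length-layered : ∀ {n} {m : Fin n → ℕ} (C : ∀ i → List (Fin (m i))) →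
                 length (layered C) ≡ sum (length ∘ C)
length-layered {m = m} C = trans
  (length-concat-tabulate λ i → map (i ,_) (C i)) (sum-cong-≗ λ i → length-map (_,_ {B = Fin ∘ m} i) (C i))

length-allFin : ∀ n → length (allFin n) ≡ n
length-allFin n = length-tabulate {n = n} id

-- Distances, distinguishing vertices and true twins.

module _ {V : Set} (G : Graph V) where

  distinguishes-sym : ∀ {s x y} → Distinguishes G s x y → Distinguishes G s y x
  distinguishes-sym (k , l , dk , dl , k≢l) = l , k , dl , dk , ≢-sym k≢l

  dist-self : ∀ {x} → IsDist G x x 0
  dist-self = [] , λ _ → z≤n

  dist-adj : ∀ {x y} → Adj G x y → IsDist G x y 1
  dist-adj e = e ∷ [] , λ { [] → ⊥-elim (adj-irrefl G refl e) ; (_ ∷ _) → s≤s z≤n }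

  adj-distinguishes-self : ∀ {x y} → Adj G x y → Distinguishes G x x y
  adj-distinguishes-self e = 0 , 1 , dist-self , dist-adj e , λ ()

  adj-distinguishes-far : ∀ {s x y} → Adj G s x → Adj G x y → s ≢ y → ¬ Adj G s y →
                          Distinguishes G s x y
  adj-distinguishes-far e f s≢y ¬sy = 1 , 2 , dist-adj e , (e ∷ f ∷ [] , shortest) , λ ()
    where
    shortest : ∀ {l} → Walk G _ _ l → 2 ≤ l
    shortest []          = ⊥-elim (s≢y refl)
    shortest (g ∷ [])    = ⊥-elim (¬sy g)
    shortest (_ ∷ _ ∷ _) = s≤s (s≤s z≤n)

module _ {V : Set} (_≟ⱽ_ : DecidableEquality V) (G : Graph V) where

  -- Follow the walk up to its first step into `x`. The vertex just before lies in N[x], hence in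
  -- N[y]: it is `y` already, or one step leads to `y` instead.
  redirect-walk : ∀ {x y} → (∀ z → InClosedNbhd G x z → InClosedNbhd G y z) →
                  ∀ {s k} → s ≢ x → Walk G s x k → ∃ λ l → l ≤ k × Walk G s y l
  redirect-walk N⊆ s≢x [] = ⊥-elim (s≢x refl)
  redirect-walk {x} N⊆ s≢x (_∷_ {y = z} e p) with z ≟ⱽ x
  ... | no z≢x = let l , l≤k , q = redirect-walk N⊆ z≢x p in suc l , s≤s l≤k , e ∷ q
  ... | yes refl with N⊆ _ (inj₂ (adj-sym G e))
  ...   | inj₁ refl = 0 , z≤n , []
  ...   | inj₂ f    = 1 , s≤s z≤n , adj-sym G f ∷ []

  -- From any other `s`, a shortest walk to either twin can be redirected to the other without
  -- getting longer, so the two distances bound each other.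
  twins-distinguished-by-selves : ∀ {s x y} → TrueTwins G x y → Distinguishes G s x y →
                                  s ≡ x ⊎ s ≡ y
  twins-distinguished-by-selves {s} {x} {y} (_ , N≡) (k , l , (p , k-min) , (q , l-min) , k≢l)
    with s ≟ⱽ x | s ≟ⱽ y
  ... | yes s≡x | _       = inj₁ s≡x
  ... | no _    | yes s≡y = inj₂ s≡y
  ... | no s≢x  | no s≢y  =
    let _ , k′≤k , q′ = redirect-walk (Equivalence.to ∘ N≡) s≢x p
        _ , l′≤l , p′ = redirect-walk (Equivalence.from ∘ N≡) s≢y q
    in ⊥-elim (k≢l (≤-antisym (≤-trans (k-min p′) l′≤l) (≤-trans (l-min q′) k′≤k)))

-- Private neighbours in a graph without true twins.

module _ {n : ℕ} (G : Graph (Fin n)) where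

  -- For adjacent `i` and `j` these `z` are exactly the elements of N[i] outside N[j], as `i` itself
  -- lies in N[j]. They have distance 1 from `i` and 2 from `j`.
  PrivateNeighbour : Fin n → Fin n → Fin n → Set
  PrivateNeighbour i j z = Adj G i z × z ≢ j × ¬ Adj G j z

  inClosedNbhd? : ∀ x z → Dec (InClosedNbhd G x z)
  inClosedNbhd? x z = z ≟ x ⊎-dec adj? G x z

  no-private⇒nbhd-⊆ : ∀ {i j} → Adj G i j → ¬ ∃ (PrivateNeighbour i j) →
                      ∀ z → InClosedNbhd G i z → InClosedNbhd G j z
  no-private⇒nbhd-⊆ e none z (inj₁ refl) = inj₂ (adj-sym G e)
  no-private⇒nbhd-⊆ {j = j} e none z (inj₂ f) =
    decidable-stable (inClosedNbhd? j z) λ z∉ → none (z , f , z∉ ∘ inj₁ , z∉ ∘ inj₂)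

  -- Without a private neighbour on either side, the closed neighbourhoods contain each other. The
  -- search over `Fin n` is decidable, so this refutation yields a witness.
  non-twins⇒private : ∀ {i j} → Adj G i j → ¬ TrueTwins G i j →
                      ∃ (PrivateNeighbour i j) ⊎ ∃ (PrivateNeighbour j i)
  non-twins⇒private {i} {j} e ¬twins = decidable-stable (private? i j ⊎-dec private? j i) λ none →
    ¬twins ((λ { refl → adj-irrefl G refl e }) , λ z → mk⇔
      (no-private⇒nbhd-⊆ e (none ∘ inj₁) z)
      (no-private⇒nbhd-⊆ (adj-sym G e) (none ∘ inj₂) z))
    where
    private? : ∀ x y → Dec (∃ (PrivateNeighbour x y))
    private? x y = any? λ z → adj? G x z ×-dec ¬? (z ≟ y) ×-dec ¬? (adj? G y z)

-- Vertex covers and completeness of a single layer.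

IsCover : ∀ {k} → Graph (Fin k) → List (Fin k) → Set
IsCover H C = ∀ {v w} → Adj H v w → v ∈ C ⊎ w ∈ C

-- Supplies the vertex of a witnessing layer that separates two adjacent layers.
nonEmpty-cover : ∀ {k} {H : Graph (Fin k)} {C} → NonEmpty H → IsCover H C → ∃ (_∈ C)
nonEmpty-cover (_ , _ , e) cover with cover e
... | inj₁ v∈C = _ , v∈C
... | inj₂ w∈C = _ , w∈C

IsComplete : ∀ {k} → Graph (Fin k) → Set
IsComplete H = ∀ {v w} → v ≢ w → Adj H v w

≅K⇒complete : ∀ {k} {H : Graph (Fin k)} → H ≅ K k → IsComplete H
≅K⇒complete iso v≢w = Equivalence.from (adj-⇔ _ _) (v≢w ∘ Injection.injective (↔⇒↣ bijection))
  where open _≅_ iso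

complete⇒≅K : ∀ {k} {H : Graph (Fin k)} → IsComplete H → H ≅ K k
complete⇒≅K {H = H} complete = record
  { bijection = ↔-id _
  ; adj-⇔     = λ _ _ → mk⇔ (λ { e refl → adj-irrefl H refl e }) complete
  }

co-vertex : ∀ {k} → Fin k → List (Fin k)
co-vertex a = without _≟_ a (allFin _)

co-vertex-covers : ∀ {k} (H : Graph (Fin k)) a → IsCover H (co-vertex a)
co-vertex-covers H a {v} {w} e with v ≟ a
... | no v≢a   = inj₁ (∈-without _≟_ (∈-allFin v) v≢a)
... | yes refl = inj₂ (∈-without _≟_ (∈-allFin w) λ { refl → adj-irrefl H refl e })

length-co-vertex : ∀ {k} (a : Fin k) → length (co-vertex a) < k
length-co-vertex {k} a =
  subst (length (co-vertex a) <_) (length-allFin k) (length-without _≟_ (∈-allFin a))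

co-pair : ∀ {k} → Fin k → Fin k → List (Fin k)
co-pair a b = without _≟_ b (co-vertex a)

-- An uncovered edge would have both ends among `a` and `b`, so it would be a loop or join `a` to
-- `b`.
co-pair-covers : ∀ {k} (H : Graph (Fin k)) {a b} → ¬ Adj H a b → IsCover H (co-pair a b)
co-pair-covers H {a} {b} ¬ab {v} {w} e with v ≟ a | v ≟ b
... | no v≢a   | no v≢b   = inj₁ (∈-without _≟_ (∈-without _≟_ (∈-allFin v) v≢a) v≢b)
... | yes refl | _        = inj₂ (∈-without _≟_ (∈-without _≟_ (∈-allFin w)
                              λ { refl → adj-irrefl H refl e }) λ { refl → ¬ab e })
... | no _     | yes refl = inj₂ (∈-without _≟_ (∈-without _≟_ (∈-allFin w)
                              λ { refl → ¬ab (adj-sym H e) }) λ { refl → adj-irrefl H refl e })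

length-co-pair : ∀ {k} {a b : Fin k} → a ≢ b → suc (length (co-pair a b)) < k
length-co-pair {a = a} {b} a≢b = ≤-trans
  (s≤s (length-without _≟_ (∈-without _≟_ (∈-allFin b) (≢-sym a≢b))))
  (length-co-vertex a)

-- Locally resolving sets of the lexicographic product.

module _ {n : ℕ} {m : Fin n → ℕ} (G : Graph (Fin n)) (H : (i : Fin n) → Graph (Fin (m i))) where

  -- Every vertex of layer `z` is adjacent to all of layer `i` and at distance 2 from all of layer
  -- `j`, which leaves `c` free to be taken from a cover.
  outer-distinguishes : ∀ {i j z} → Adj G i j → PrivateNeighbour G i j z →
                        ∀ {c v w} → Distinguishes (G ⊚ H) (z , c) (i , v) (j , w)
  outer-distinguishes e (iz , z≢j , ¬jz) =
    adj-distinguishes-far (G ⊚ H) (outer (adj-sym G iz)) (outer e) (z≢j ∘ cong proj₁)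
      λ { (outer f) → ¬jz (adj-sym G f) ; (inner _) → z≢j refl }

  covers-resolve : (∀ x y → ¬ TrueTwins G x y) → (∀ i → NonEmpty (H i)) →
                   ∀ {C} → (∀ i → IsCover (H i) (C i)) →
                   LocallyResolving (G ⊚ H) (layered C)
  covers-resolve noTwins nonEmpty covers (inner {i} e) with covers i e
  ... | inj₁ v∈C = _ , ∈-layered v∈C , adj-distinguishes-self (G ⊚ H) (inner e)
  ... | inj₂ w∈C = _ , ∈-layered w∈C ,
        distinguishes-sym (G ⊚ H) (adj-distinguishes-self (G ⊚ H) (inner (adj-sym (H i) e)))
  covers-resolve noTwins nonEmpty covers (outer {i} {j} e)
    with non-twins⇒private G e (noTwins i j)
  ... | inj₁ (z , pz) = let c , c∈C = nonEmpty-cover {H = H z} (nonEmpty z) (covers z) in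
        (z , c) , ∈-layered c∈C , outer-distinguishes e pz
  ... | inj₂ (z , pz) = let c , c∈C = nonEmpty-cover {H = H z} (nonEmpty z) (covers z) in
        (z , c) , ∈-layered c∈C ,
        distinguishes-sym (G ⊚ H) (outer-distinguishes (adj-sym G e) pz)

  -- Vertices of one layer always share their neighbours in other layers; completeness makes them
  -- agree inside the layer too.
  complete-layer-twins : ∀ {i} → IsComplete (H i) → ∀ {v w} → v ≢ w →
                         TrueTwins (G ⊚ H) (i , v) (i , w)
  complete-layer-twins {i} complete v≢w =
    (λ { refl → v≢w refl }) , λ z → mk⇔ (nbhd-⊆ v≢w z) (nbhd-⊆ (≢-sym v≢w) z)
    where
    nbhd-⊆ : ∀ {v w} → v ≢ w → ∀ z →
             InClosedNbhd (G ⊚ H) (i , v) z → InClosedNbhd (G ⊚ H) (i , w) z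
    nbhd-⊆ v≢w _ (inj₁ refl)      = inj₂ (inner (complete (≢-sym v≢w)))
    nbhd-⊆ v≢w _ (inj₂ (outer e)) = inj₂ (outer e)
    nbhd-⊆ {w = w} v≢w (_ , u) (inj₂ (inner _)) with u ≟ w
    ... | yes refl = inj₁ refl
    ... | no u≢w   = inj₂ (inner (complete (≢-sym u≢w)))

  complete-layer-misses-one : ∀ {i S} → IsComplete (H i) → LocallyResolving (G ⊚ H) S →
                              ∀ {v w} → v ≢ w → (i , v) ∈ S ⊎ (i , w) ∈ S
  complete-layer-misses-one complete resolving v≢w =
    let _ , s∈S , d = resolving (inner (complete v≢w)) in
    case s∈S (twins-distinguished-by-selves (≡-dec _≟_ _≟_) (G ⊚ H)
                 (complete-layer-twins complete v≢w) d)
    where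
    case : ∀ {s x y S} → s ∈ S → s ≡ x ⊎ s ≡ y → x ∈ S ⊎ y ∈ S
    case s∈S (inj₁ refl) = inj₁ s∈S
    case s∈S (inj₂ refl) = inj₂ s∈S

  -- Adding to `S` one vertex per layer, the missed one if there is one, exhausts the product, whose
  -- order is `sum m`.
  complete⇒resolving-large : (∀ i → Fin (m i)) → (∀ i → IsComplete (H i)) →
                             ∀ S → LocallyResolving (G ⊚ H) S → sum m ≤ length S + n
  complete⇒resolving-large point complete S resolving = begin
    sum m                                    ≡⟨ sum-cong-≗ (sym ∘ length-allFin ∘ m) ⟩
    sum (λ i → length (allFin (m i)))        ≡⟨ length-layered (allFin ∘ m) ⟨
    length (layered (allFin ∘ m))            ≤⟨ unique-⊆⇒length-≤ (≡-dec _≟_ _≟_)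
                                                  (layered-unique (allFin⁺ ∘ m)) (λ {x} _ → spans x) ⟩
    length (S ++ map rep (allFin n))         ≡⟨ length-++ S ⟩
    length S + length (map rep (allFin n))   ≡⟨ cong (length S +_)
                                                  (trans (length-map rep (allFin n)) (length-allFin n)) ⟩
    length S + n                             ∎
    where
    open ≤-Reasoning

    missed : ∀ i → ∃ λ v → ∀ w → w ≢ v → (i , w) ∈ S
    missed i with any? (λ v → ¬? (mem? (≡-dec _≟_ _≟_) (i , v) S))
    -- `S` contains the whole layer, so any vertex serves as representative; its repetition in the
    -- combined list is harmless for an upper bound.
    ... | no none = point i , λ w _ →
            decidable-stable (mem? (≡-dec _≟_ _≟_) (i , w) S) λ w∉S → none (w , w∉S)
    ... | yes (v , v∉S) = v , λ w w≢v →
            other (complete-layer-misses-one (complete i) resolving w≢v)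
      where
      other : ∀ {w} → (i , w) ∈ S ⊎ (i , v) ∈ S → (i , w) ∈ S
      other (inj₁ w∈S) = w∈S
      other (inj₂ v∈S) = ⊥-elim (v∉S v∈S)

    rep : Fin n → Σ (Fin n) λ i → Fin (m i)
    rep i = i , proj₁ (missed i)

    spans : ∀ x → x ∈ S ++ map rep (allFin n)
    spans (i , w) with w ≟ proj₁ (missed i)
    ... | yes refl = ∈-++⁺ʳ S (∈-map⁺ rep (∈-allFin i))
    ... | no w≢    = ∈-++⁺ˡ (proj₂ (missed i) w w≢)

-- Moves `n` to the side of the list, so that comparison with `sum m` becomes layerwise,
-- `suc (length (C i))` against `m i`, with no truncated subtraction.
layered+n≡sum-suc : ∀ {n} {m : Fin n → ℕ} (C : ∀ i → List (Fin (m i))) →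
                    length (layered C) + n ≡ sum (suc ∘ length ∘ C)
layered+n≡sum-suc {n} C = trans (cong (_+ n) (length-layered C)) (sym (sum-suc (length ∘ C)))

theorem4 : (n : ℕ) → 2 ≤ n →
    (G : Graph (Fin n)) → Connected G →
    (∀ x y → ¬ TrueTwins G x y) →
    (m : Fin n → ℕ) (H : (i : Fin n) → Graph (Fin (m i))) →
    (∀ i → NonEmpty (H i)) →
    IsLocalDim (G ⊚ H) (sum m ∸ n) ⇔ (∀ i → H i ≅ K (m i))
theorem4 n _ G _ noTwins m H nonEmpty =
  mk⇔ (λ dim i → complete⇒≅K (λ {v} {w} → dim⇒complete dim i v w))
      (λ iso → complete⇒dim λ i → ≅K⇒complete (iso i))
  where
  point : ∀ i → Fin (m i)
  point i = proj₁ (nonEmpty i)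

  -- A missing edge in layer `i` allows two vertices to be dropped there and one in every other
  -- layer, giving a locally resolving set that is too small.
  dim⇒complete : IsLocalDim (G ⊚ H) (sum m ∸ n) → ∀ i v w → v ≢ w → Adj (H i) v w
  dim⇒complete (_ , minimal) i v w v≢w = decidable-stable (adj? (H i) v w) λ ¬vw →
    let cover = layer-cover ¬vw
        C    = λ j → proj₁ (cover j)
        size = λ j → proj₁ (proj₂ (proj₂ (proj₂ (cover j))))
        thin = proj₂ (proj₂ (proj₂ (proj₂ (cover i)))) refl
        small : length (layered C) + n < sum m
        small = subst (_< sum m) (sym (layered+n≡sum-suc C)) (sum-mono-< size i thin)
    -- Keeping the `suc` while subtracting `n` puts the size strictly below `sum m ∸ n`, against
    -- minimality.
    in <-irrefl refl (≤-trans (m+n≤o⇒m≤o∸n (suc (length (layered C))) small)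
         (minimal (layered C) (layered-unique λ j → proj₁ (proj₂ (cover j)))
           (covers-resolve G H noTwins nonEmpty λ j → proj₁ (proj₂ (proj₂ (cover j))))))
    where
    -- Cover and properties are bundled so that one decision of `i ≟ j` settles them all; the last
    -- component records the extra saving in layer `i`.
    layer-cover : ¬ Adj (H i) v w → ∀ j → Σ (List (Fin (m j))) λ C → Unique C × IsCover (H j) C ×
                 length C < m j × (i ≡ j → suc (length C) < m j)
    layer-cover ¬vw j with i ≟ j
    ... | yes refl = co-pair v w , filter⁺ _ (filter⁺ _ (allFin⁺ _)) , co-pair-covers (H i) ¬vw ,
                     <⇒≤ (length-co-pair v≢w) , λ _ → length-co-pair v≢w
    ... | no i≢j   = co-vertex (point j) , filter⁺ _ (allFin⁺ _) ,
                     co-vertex-covers (H j) (point j) , length-co-vertex (point j) , ⊥-elim ∘ i≢j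

  complete⇒dim : (∀ i → IsComplete (H i)) → IsLocalDim (G ⊚ H) (sum m ∸ n)
  complete⇒dim complete =
    (layered C , layered-unique (λ i → filter⁺ _ (allFin⁺ _)) , resolving ,
      -- The strict bound in each layer gives one inequality; the other is the lower bound valid for
      -- every locally resolving set.
      ≤-antisym (m+n≤o⇒m≤o∸n _ (subst (_≤ sum m) (sym (layered+n≡sum-suc C))
                  (sum-mono-≤ λ i → length-co-vertex (point i))))
                (lower (layered C) resolving)) ,
    λ S _ → lower S
    where
    C : ∀ i → List (Fin (m i))
    C i = co-vertex (point i)

    resolving : LocallyResolving (G ⊚ H) (layered C)
    resolving = covers-resolve G H noTwins nonEmpty λ i → co-vertex-covers (H i) (point i)

    lower : ∀ S → LocallyResolving (G ⊚ H) S → sum m ∸ n ≤ length S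
    lower S r = m≤n+o⇒m∸n≤o (sum m) n
      (subst (sum m ≤_) (+-comm (length S) n) (complete⇒resolving-large G H point complete S r))
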